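{- For any finite functional signature $\Sigma$ which contains at least one constant symbol, and which contains at least one binary function symbol or at least two unary function symbols, there exists a non-initial algebra $\mathcal{A}$ over $\Sigma$, generated by the constants of $\Sigma$, with a polynomial time word problem.
   Context: An algebra over $\Sigma$ is a $\Sigma$-structure with all operations total. $\mathcal{F}$ denotes the algebra of all ground terms (terms without variables) over $\Sigma$. An equation is an expression $p=q$ with $p,q$ terms over $\Sigma$, possibly containing variables (understood as universally quantified). For a set $\Gamma$ of equations, $\sim_\Gamma$ is the congruence on $\mathcal{F}$ given by $p\sim_\Gamma q$ iff $\Gamma\vdash p=q$ (equivalently, the smallest congruence on $\mathcal{F}$ containing all ground instances of equations in $\Gamma$), and $\mathcal{F}_\Gamma=\mathcal{F}/{\sim_\Gamma}$. An algebra is initial if it is isomorphic to $\mathcal{F}_\Gamma$ for some finite set $\Gamma$ of equations (not necessarily between ground terms); otherwise it is non-initial. The word problem of an algebra $\mathcal{A}$ generated by its constants is: given ground terms $u,t$, decide whether $\mathcal{A}\models u=t$. It is polynomial time if it is decidable in time polynomial in $|u|+|t|$, where the size $|t|$ of a ground term is the number of nodes of its syntax tree. -}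

module Defs where

open import Level using (0ℓ)
open import Data.Bool.Base using (Bool)
open import Data.Empty using (⊥)
open import Data.Fin.Base using (Fin)
open import Data.List.Base as List using (List; []; _∷_; _++_; concat)
open import Data.List.Membership.Propositional using (_∈_)
open import Data.Maybe.Base using (Maybe; just; nothing)
open import Data.Nat.Base using (ℕ; zero; suc; _+_; _*_; _^_)
open import Data.Product.Base using (_×_; _,_; ∃)
open import Data.Sum.Base using (_⊎_; inj₁; inj₂)
open import Data.Vec.Base as Vec using (Vec; []; _∷_)
open import Data.Vec.Relation.Binary.Pointwise.Inductive using (Pointwise; []; _∷_)
open import Function.Bundles using (_↔_; Inverse)
open import Relation.Binary.Bundles using (Setoid)
open import Relation.Binary.PropositionalEquality.Core using (_≡_)
open import Relation.Nullary using (Reflects)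

Finite : Set → Set
Finite A = ∃ λ n → A ↔ Fin n

record Signature : Set₁ where
  field
    Sym    : Set
    finite : Finite Sym
    arity  : Sym → ℕ

-- Multi-tape deterministic Turing machines with input alphabet In.

data Cell (In Work : Set) : Set where
  blank : Cell In Work
  input : In → Cell In Work
  work  : Work → Cell In Work

data Move : Set where
  left stay right : Move

-- There are  suc extraTapes  two-way infinite tapes. A transition either halts
-- with a verdict (true = accept), or gives the next state and, for each tape,
-- the symbol to write and the direction to move.
record TuringMachine (In : Set) : Set₁ where
  field
    State       : Set
    stateFinite : Finite State
    Work        : Set
    workFinite  : Finite Work
    extraTapes  : ℕ
    start       : State
    δ           : State → Vec (Cell In Work) (suc extraTapes) →
                  Bool ⊎ (State × Vec (Cell In Work × Move) (suc extraTapes))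

-- lefts and rights list the cells on either side of the head, nearest first;
-- all cells beyond the ends of these lists are blank.
record Tape (In Work : Set) : Set where
  constructor tape
  field
    lefts  : List (Cell In Work)
    head   : Cell In Work
    rights : List (Cell In Work)

module _ {In Work : Set} where

  fromCells : List (Cell In Work) → Tape In Work
  fromCells []       = tape [] blank []
  fromCells (a ∷ as) = tape [] a as

  act : Cell In Work × Move → Tape In Work → Tape In Work
  act (a , left)  (tape []       _ rs) = tape [] blank (a ∷ rs)
  act (a , left)  (tape (l ∷ ls) _ rs) = tape ls l (a ∷ rs)
  act (a , stay)  (tape ls       _ rs) = tape ls a rs
  act (a , right) (tape ls _ [])       = tape (a ∷ ls) blank []
  act (a , right) (tape ls _ (r ∷ rs)) = tape (a ∷ ls) r rs

module _ {In : Set} (M : TuringMachine In) where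
  open TuringMachine M

  record Config : Set where
    constructor config
    field
      state : State
      tapes : Vec (Tape In Work) (suc extraTapes)

  -- The first tape holds the input, with the head on its first letter; the
  -- remaining tapes are blank.
  initial : List In → Config
  initial w = config start
    (fromCells (List.map input w) ∷ Vec.replicate extraTapes (fromCells []))

  step : Config → Bool ⊎ Config
  step (config q ts) with δ q (Vec.map Tape.head ts)
  ... | inj₁ verdict        = inj₁ verdict
  ... | inj₂ (q′ , actions) = inj₂ (config q′ (Vec.zipWith act actions ts))

  -- run n c  is  just b  iff the computation from c halts with verdict b
  -- within n steps.
  run : ℕ → Config → Maybe Bool
  run zero    c = nothing
  run (suc n) c with step c
  ... | inj₁ verdict = just verdict
  ... | inj₂ c′      = run n c′

module _ (S : Signature) where
  open Signature S

  data Term (V : Set) : Set where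
    var : V → Term V
    op  : (f : Sym) → Vec (Term V) (arity f) → Term V

  module _ {V X : Set} (onVar : V → X) (onOp : (f : Sym) → Vec X (arity f) → X) where
    mutual
      fold : Term V → X
      fold (var v)   = onVar v
      fold (op f ts) = onOp f (foldVec ts)

      foldVec : ∀ {n} → Vec (Term V) n → Vec X n
      foldVec []       = []
      foldVec (t ∷ ts) = fold t ∷ foldVec ts

  substitute : {V W : Set} → (V → Term W) → Term V → Term W
  substitute σ = fold σ op

  GroundTerm : Set
  GroundTerm = Term ⊥

  size : GroundTerm → ℕ
  size = fold (λ ()) (λ _ ns → suc (Vec.sum ns))

  record Algebra : Set₁ where
    field
      setoid  : Setoid 0ℓ 0ℓ
    open Setoid setoid public
    field
      ⟦_⟧     : (f : Sym) → Vec Carrier (arity f) → Carrier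
      ⟦⟧-cong : ∀ f {xs ys} → Pointwise _≈_ xs ys → ⟦ f ⟧ xs ≈ ⟦ f ⟧ ys

  value : (A : Algebra) → GroundTerm → Algebra.Carrier A
  value A = fold (λ ()) (Algebra.⟦_⟧ A)

  _⊨_≈_ : Algebra → GroundTerm → GroundTerm → Set
  A ⊨ u ≈ t = Algebra._≈_ A (value A u) (value A t)

  GeneratedByConstants : Algebra → Set
  GeneratedByConstants A = ∀ x → ∃ λ t → Algebra._≈_ A (value A t) x

  record _≅_ (A B : Algebra) : Set where
    private
      module A = Algebra A
      module B = Algebra B
    field
      inverse : Inverse A.setoid B.setoid
    open Inverse inverse using (to)
    field
      homo : ∀ f xs → to (A.⟦ f ⟧ xs) B.≈ B.⟦ f ⟧ (Vec.map to xs)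

  Equation : Set
  Equation = Term ℕ × Term ℕ

  -- The smallest congruence on ground terms containing all ground instances of
  -- equations in Γ.
  data _⊢_∼_ (Γ : List Equation) : GroundTerm → GroundTerm → Set where
    instance-of : ∀ {p q} → (p , q) ∈ Γ → (σ : ℕ → GroundTerm) →
                  Γ ⊢ substitute σ p ∼ substitute σ q
    ∼-refl      : ∀ {p} → Γ ⊢ p ∼ p
    ∼-sym       : ∀ {p q} → Γ ⊢ p ∼ q → Γ ⊢ q ∼ p
    ∼-trans     : ∀ {p q r} → Γ ⊢ p ∼ q → Γ ⊢ q ∼ r → Γ ⊢ p ∼ r
    ∼-cong      : ∀ f {ps qs} → Pointwise (Γ ⊢_∼_) ps qs → Γ ⊢ op f ps ∼ op f qs

  -- The quotient of the ground term algebra by Γ ⊢_∼_ .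
  𝓕/ : List Equation → Algebra
  𝓕/ Γ = record
    { setoid  = record
      { Carrier       = GroundTerm
      ; _≈_           = Γ ⊢_∼_
      ; isEquivalence = record { refl = ∼-refl ; sym = ∼-sym ; trans = ∼-trans }
      }
    ; ⟦_⟧     = op
    ; ⟦⟧-cong = ∼-cong
    }

  Initial : Algebra → Set
  Initial A = ∃ λ (Γ : List Equation) → A ≅ 𝓕/ Γ

  data Letter : Set where
    sym : Sym → Letter
    sep : Letter

  -- Prefix (Polish) notation: one letter per node, uniquely readable because
  -- arities are fixed.
  polish : GroundTerm → List Letter
  polish = fold (λ ()) (λ f ws → sym f ∷ concat (Vec.toList ws))

  encode : GroundTerm → GroundTerm → List Letter
  encode u t = polish u ++ sep ∷ polish t

  -- Some Turing machine decides A ⊨ u ≈ t  in time O((|u| + |t|) ^ d).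
  PolynomialTimeWordProblem : Algebra → Set₁
  PolynomialTimeWordProblem A =
    ∃ λ (M : TuringMachine Letter) → ∃ λ (c : ℕ) → ∃ λ (d : ℕ) →
      ∀ u t → ∃ λ b →
        run M (c * (size u + size t) ^ d + c) (initial M (encode u t)) ≡ just b
        × Reflects (A ⊨ u ≈ t) b

{-# OPTIONS --safe #-}

-- Fix a sequence of ground terms τ n: with unary f, g take τ n = f gⁿ⁺¹ c; with
-- binary b put g x = b(c, x) and take τ n = b(gⁿ⁺¹ c, c). Let A be the Rees quotient
-- of the term algebra collapsing all terms that have some τ n as a subterm; it is the
-- union of the strictly increasing sequence of congruences ≈[ N ] that collapse only
-- the terms containing some τ n with n ≤ N. If an equation p = q holds in A and p
-- contains no τ n, then p and q agree after substituting any of two terms o, o′ of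
-- different sizes, chosen so that this creates no τ n; hence p and q are the same
-- term. Otherwise both contain some τ n. In either case all instances of p = q lie in
-- one ≈[ N ], so finitely many valid equations never generate the union. In Polish
-- notation, containing some τ n is recognised by a finite automaton, and the
-- remaining comparison of two words takes linear time on two tapes.
module Submission where

open import Defs
open import Data.Bool.Base using (Bool; true; false; if_then_else_)
open import Data.Empty using (⊥)
open import Data.Fin.Base using (Fin; zero; suc)
open import Data.Fin.Patterns using (0F; 1F; 2F; 3F; 4F)
open import Data.Fin.Properties using (0↔⊥; 2↔Bool; +↔⊎; inj⇒≟)
open import Data.List.Base using (List; []; _∷_; _++_; _ʳ++_; concat; foldl; length; map)
open import Data.List.Membership.Propositional using (_∈_)
open import Data.List.Properties
  using (++-assoc; foldl-++; length-++; length-ʳ++; map-++; map-ʳ++; map-∘; ʳ++-ʳ++; ∷-injective; ≡-dec)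
open import Data.List.Relation.Unary.Any using (here; there)
open import Data.Maybe.Base using (Maybe; just; nothing; _>>=_; is-nothing)
open import Data.Nat.Base using (ℕ; suc; _+_; _*_; _^_; _⊓_; _⊔_; _≤_; s≤s)
import Data.Nat.Properties as ℕ
open import Data.Nat.Tactic.RingSolver using (solve-∀)
open import Data.Product.Base using (_×_; _,_; ∃; map₁; map₂; proj₁; proj₂)
open import Data.Sum.Base using (_⊎_; inj₁; inj₂)
open import Data.Sum.Function.Propositional using (_⊎-↔_)
open import Data.Unit.Base using (⊤; tt)
open import Data.Vec.Base as Vec using (Vec; []; _∷_; toList)
open import Data.Vec.Properties using (∷-injectiveˡ; ∷-injectiveʳ)
open import Data.Vec.Relation.Binary.Pointwise.Inductive as Pointwise using (Pointwise; []; _∷_)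
open import Function.Base using (const; _∘_)
open import Function.Bundles using (_↔_; Inverse; mk↔ₛ′)
open import Function.Properties.Inverse using (↔-sym; ↔-trans; ↔⇒↣)
open import Relation.Binary.Definitions using (DecidableEquality)
open import Relation.Binary.PropositionalEquality
  using (_≡_; _≢_; refl; trans; ≢-sym; cong; cong₂; subst; subst₂; module ≡-Reasoning)
  renaming (sym to ≡-sym)
open import Relation.Nullary using (¬_; yes; no; does; Reflects; ofʸ; ofⁿ; contradiction)
open import Relation.Nullary.Decidable using (dec-true; dec-false)

open ≡-Reasoning

-- Runs of machines and moves on tapes

run-mono : ∀ {In} (M : TuringMachine In) {m n b} c →
           m ≤ n → run M m c ≡ just b → run M n c ≡ just b
run-mono M c (s≤s m≤n) eq with step M c
... | inj₁ _  = eq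
... | inj₂ c′ = run-mono M c′ m≤n eq

module _ {In Work : Set} where

  -- The tape reached after a move onto the nearest cell of one side, which is blank if that side is
  -- exhausted. Stating runs with these avoids a case split at every move.
  rightwards leftwards : List (Cell In Work) → List (Cell In Work) → Tape In Work
  rightwards ls []       = tape ls blank []
  rightwards ls (a ∷ as) = tape ls a as
  leftwards []       rs = tape [] blank rs
  leftwards (a ∷ ls) rs = tape ls a rs

  act-right : ∀ a b ls rs → act (a , right) (tape ls b rs) ≡ rightwards (a ∷ ls) rs
  act-right a b ls []       = refl
  act-right a b ls (r ∷ rs) = refl

  act-left : ∀ a b ls rs → act (a , left) (tape ls b rs) ≡ leftwards ls (a ∷ rs)
  act-left a b []       rs = refl
  act-left a b (l ∷ ls) rs = refl

-- A two-tape machine comparing two words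

module Comparison
  (S : Signature) (_≟_ : DecidableEquality (Signature.Sym S)) {k : ℕ}
  (start : Maybe (Fin k)) (advance : Maybe (Fin k) → Signature.Sym S → Maybe (Fin k))
  (accepting : Maybe (Fin k) → Bool)
  where

  open Signature S using (Sym)

  final : List Sym → Maybe (Fin k)
  final = foldl advance start

  -- An accepted u equals t in the Rees quotient iff t is accepted, so the words need
  -- to be compared only if u is rejected; the machine then rewinds its copy of u.
  verdict : List Sym → List Sym → Bool
  verdict u v = if accepting (final u) then accepting (final v) else does (≡-dec _≟_ u v)

  -- `copy` runs the automaton on the first word while duplicating it on the second tape, and `scan`
  -- runs it on the second word; `rewind` and `compare` share the `Bool`.
  State : Set
  State = Maybe (Fin k) ⊎ Maybe (Fin k) ⊎ Bool

  pattern copy q  = inj₁ q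
  pattern scan q  = inj₂ (inj₁ q)
  pattern rewind  = inj₂ (inj₂ false)
  pattern compare = inj₂ (inj₂ true)
  pattern letter s = input (Letter.sym s)

  Maybe↔Fin : Maybe (Fin k) ↔ Fin (suc k)
  Maybe↔Fin = mk↔ₛ′
    (λ { nothing → zero ; (just i) → suc i }) (λ { zero → nothing ; (suc i) → just i })
    (λ { zero → refl ; (suc i) → refl }) (λ { nothing → refl ; (just i) → refl })

  machine : TuringMachine (Letter S)
  machine = record
    { State       = State
    ; stateFinite = _ , ↔-trans
        (Maybe↔Fin ⊎-↔ ↔-trans (Maybe↔Fin ⊎-↔ ↔-sym 2↔Bool) (↔-sym +↔⊎))
        (↔-sym +↔⊎)
    ; Work        = ⊥
    ; workFinite  = 0 , ↔-sym 0↔⊥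
    ; extraTapes  = 1
    ; start       = copy start
    ; δ           = λ
      { (copy q) (letter s ∷ _ ∷ []) →
          inj₂ (copy (advance q s) , (letter s , right) ∷ (letter s , right) ∷ [])
      -- On the intended input this is the separator. The second head stands on the blank after the
      -- copy, so rewinding starts with a step to the left.
      ; (copy q) (a ∷ b ∷ []) →
          if accepting q
          then inj₂ (scan start , (a , right) ∷ (b , stay) ∷ [])
          else inj₂ (rewind , (a , right) ∷ (b , left) ∷ [])
      ; (scan q) (letter s ∷ b ∷ []) →
          inj₂ (scan (advance q s) , (letter s , right) ∷ (b , stay) ∷ [])
      ; (scan q) (_ ∷ _ ∷ []) → inj₁ (accepting q)
      ; rewind (a ∷ blank ∷ []) → inj₂ (compare , (a , stay) ∷ (blank , right) ∷ [])
      ; rewind (a ∷ b ∷ []) → inj₂ (rewind , (a , stay) ∷ (b , left) ∷ [])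
      ; compare (blank ∷ blank ∷ []) → inj₁ true
      ; compare (letter s ∷ letter t ∷ []) →
          if does (s ≟ t)
          then inj₂ (compare , (letter s , right) ∷ (letter t , right) ∷ [])
          else inj₁ false
      ; compare _ → inj₁ false
      }
    }

  private
    T : Set
    T = Tape (Letter S) ⊥

    Go : ℕ → State → T → T → Maybe Bool
    Go n q t₁ t₂ = run machine n (config q (t₁ ∷ t₂ ∷ []))

  letters : List Sym → List (Cell (Letter S) ⊥)
  letters = map (λ s → letter s)

  scan-run : ∀ v q ls t → Go (suc (length v)) (scan q) (rightwards ls (letters v)) t ≡
                          just (accepting (foldl advance q v))
  scan-run []      q ls t = refl
  scan-run (s ∷ v) q ls t = begin
    Go (suc (length v)) (scan (advance q s)) (act (letter s , right) (tape ls (letter s) (letters v))) t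
      ≡⟨ cong (λ t₁ → Go (suc (length v)) (scan (advance q s)) t₁ t) (act-right _ _ ls (letters v)) ⟩
    Go (suc (length v)) (scan (advance q s)) (rightwards (letter s ∷ ls) (letters v)) t
      ≡⟨ scan-run v (advance q s) (letter s ∷ ls) t ⟩
    just (accepting (foldl advance q (s ∷ v))) ∎

  -- The trailing blank is the cell written at the end of the copy when rewinding began. Each step
  -- either halts or consumes a letter of `v`, and the last one sees its end.
  compare-run : ∀ u v ls ls′ →
    Go (suc (length v)) compare (rightwards ls (letters v)) (rightwards ls′ (letters u ++ blank ∷ [])) ≡
    just (does (≡-dec _≟_ u v))
  compare-run []      []      ls ls′ = refl
  compare-run []      (_ ∷ _) ls ls′ = refl
  compare-run (_ ∷ _) []      ls ls′ = refl
  compare-run (s ∷ u) (t ∷ v) ls ls′ with s ≟ t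
  -- The first tape holds `v`, so the machine tests the letters in the opposite order.
  ... | no  s≢t rewrite dec-false (t ≟ s) (≢-sym s≢t) = refl
  ... | yes refl rewrite dec-true (s ≟ s) refl = begin
    Go (suc (length v)) compare
      (act (letter s , right) (tape ls (letter s) (letters v)))
      (act (letter s , right) (tape ls′ (letter s) (letters u ++ blank ∷ [])))
      ≡⟨ cong₂ (Go (suc (length v)) compare)
           (act-right _ _ ls (letters v)) (act-right _ _ ls′ (letters u ++ blank ∷ [])) ⟩
    Go (suc (length v)) compare
      (rightwards (letter s ∷ ls) (letters v)) (rightwards (letter s ∷ ls′) (letters u ++ blank ∷ []))
      ≡⟨ compare-run u v _ _ ⟩
    just (does (≡-dec _≟_ u v)) ∎

  -- Here `u` is the word as met when moving left, hence the reversed copy. The extra step is the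
  -- turn at the blank in front of the copy.
  rewind-run : ∀ n u t rs →
    Go (length u + suc n) rewind t (leftwards (letters u) rs) ≡
    Go n compare t (rightwards (blank ∷ []) (letters u ʳ++ rs))
  rewind-run n []      t rs = cong (Go n compare t) (act-right blank blank [] rs)
  rewind-run n (s ∷ u) t rs = trans
    (cong (Go (length u + suc n) rewind t) (act-left (letter s) (letter s) (letters u) rs))
    (rewind-run n u t (letter s ∷ rs))

  copy-run : ∀ n u q ls ls′ rest →
    Go (length u + n) (copy q) (rightwards ls (letters u ++ rest)) (tape ls′ blank []) ≡
    Go n (copy (foldl advance q u))
      (rightwards (letters u ʳ++ ls) rest) (tape (letters u ʳ++ ls′) blank [])
  copy-run n []      q ls ls′ rest = refl
  copy-run n (s ∷ u) q ls ls′ rest = trans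
    (cong (λ t → Go (length u + n) (copy (advance q s)) t (tape (letter s ∷ ls′) blank []))
      (act-right _ _ ls (letters u ++ rest)))
    (copy-run n u (advance q s) (letter s ∷ ls) (letter s ∷ ls′) rest)

  separator-step : ∀ n q ls ls′ rest →
    Go (suc n) (copy q) (tape ls (input sep) rest) (tape ls′ blank []) ≡
    (if accepting q
     then Go n (scan start) (rightwards (input sep ∷ ls) rest) (tape ls′ blank [])
     else Go n rewind (rightwards (input sep ∷ ls) rest) (leftwards ls′ (blank ∷ [])))
  separator-step n q ls ls′ rest with accepting q
  ... | true  = cong (λ t → Go n (scan start) t (tape ls′ blank [])) (act-right _ _ ls rest)
  ... | false = cong₂ (Go n rewind) (act-right _ _ ls rest) (act-left _ _ ls′ [])

  -- The fuel pays for the separator, for rewinding `length u` letters, for the turn, and for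
  -- `suc (length v)` steps of comparison; scanning needs only the last amount.
  separator-run : ∀ u v ls →
    Go (suc (length u + suc (suc (length v)))) (copy (final u))
      (tape ls (input sep) (letters v)) (tape (letters u ʳ++ []) blank []) ≡
    just (verdict u v)
  separator-run u v ls = trans
    (separator-step (length u + suc (suc (length v))) (final u) ls (letters u ʳ++ []) (letters v))
    branches
    where
    t₁ : T
    t₁ = rightwards (input sep ∷ ls) (letters v)

    reversed : letters (u ʳ++ []) ≡ letters u ʳ++ []
    reversed = map-ʳ++ _ u

    restored : letters (u ʳ++ []) ʳ++ (blank ∷ []) ≡ letters u ++ blank ∷ []
    restored = trans (cong (_ʳ++ (blank ∷ [])) reversed) (ʳ++-ʳ++ (letters u))

    branches : (if accepting (final u)
                then Go (length u + suc (suc (length v))) (scan start) t₁ (tape (letters u ʳ++ []) blank [])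
                else Go (length u + suc (suc (length v))) rewind t₁
                       (leftwards (letters u ʳ++ []) (blank ∷ []))) ≡
               just (verdict u v)
    branches with accepting (final u)
    ... | true  = run-mono machine _
                    (ℕ.≤-trans (ℕ.n≤1+n _) (ℕ.m≤n+m _ (length u))) (scan-run v start _ _)
    ... | false = begin
      Go (length u + suc (suc (length v))) rewind t₁ (leftwards (letters u ʳ++ []) (blank ∷ []))
        ≡⟨ cong (λ as → Go (length u + suc (suc (length v))) rewind t₁ (leftwards as (blank ∷ []))) reversed ⟨
      Go (length u + suc (suc (length v))) rewind t₁ (leftwards (letters (u ʳ++ [])) (blank ∷ []))
        ≡⟨ cong (λ m → Go (m + suc (suc (length v))) rewind t₁
                         (leftwards (letters (u ʳ++ [])) (blank ∷ [])))
             (trans (length-ʳ++ u) (ℕ.+-identityʳ (length u))) ⟨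
      Go (length (u ʳ++ []) + suc (suc (length v))) rewind t₁ (leftwards (letters (u ʳ++ [])) (blank ∷ []))
        ≡⟨ rewind-run (suc (length v)) (u ʳ++ []) t₁ (blank ∷ []) ⟩
      Go (suc (length v)) compare t₁ (rightwards (blank ∷ []) (letters (u ʳ++ []) ʳ++ (blank ∷ [])))
        ≡⟨ cong (λ as → Go (suc (length v)) compare t₁ (rightwards (blank ∷ []) as)) restored ⟩
      Go (suc (length v)) compare t₁ (rightwards (blank ∷ []) (letters u ++ blank ∷ []))
        ≡⟨ compare-run u v _ _ ⟩
      just (does (≡-dec _≟_ u v)) ∎

  machine-run : ∀ u v →
    run machine (3 * (length u + length v) ^ 1 + 3)
      (initial machine (map Letter.sym u ++ sep ∷ map Letter.sym v)) ≡
    just (verdict u v)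
  machine-run u v = begin
    run machine bound (initial machine (map Letter.sym u ++ sep ∷ map Letter.sym v))
      ≡⟨ cong (λ t → Go bound (copy start) t (tape [] blank [])) (first-tape u) ⟩
    Go bound (copy start) (rightwards [] (letters u ++ input sep ∷ letters v)) (tape [] blank [])
      ≡⟨ run-mono machine _ time (trans
           (copy-run (suc (length u + suc (suc (length v)))) u start [] [] (input sep ∷ letters v))
           (separator-run u v (letters u ʳ++ []))) ⟩
    just (verdict u v) ∎
    where
    bound : ℕ
    bound = 3 * (length u + length v) ^ 1 + 3

    contents : ∀ u → map input (map Letter.sym u ++ sep ∷ map Letter.sym v) ≡
                     letters u ++ input sep ∷ letters v
    contents []      = cong (input sep ∷_) (≡-sym (map-∘ v))
    contents (s ∷ u) = cong (letter s ∷_) (contents u)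

    first-tape : ∀ u → fromCells (map input (map Letter.sym u ++ sep ∷ map Letter.sym v)) ≡
                       rightwards [] (letters u ++ input sep ∷ letters v)
    first-tape u rewrite contents u with letters u
    ... | []    = refl
    ... | _ ∷ _ = refl

    time : length u + suc (length u + suc (suc (length v))) ≤ bound
    -- For lengths `m` and `n` the run takes at most `2m + n + 3` steps; the surplus `m + 2n` rounds
    -- this up to the bound.
    time = subst (length u + suc (length u + suc (suc (length v))) ≤_)
      (identity (length u) (length v)) (ℕ.m≤m+n _ (length u + 2 * length v))
      where
      identity : ∀ m n → m + suc (m + suc (suc n)) + (m + 2 * n) ≡ 3 * ((m + n) * 1) + 3
      identity = solve-∀

-- Classes of terms and their order

-- The class of a term at X = ℕ: regular n is gⁿ c, marked n contains some τ m and n is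
-- the least such m, dead is anything else; a list of terms has a class at X = List ℕ.
data Class (X : Set) : Set where
  regular : X → Class X
  dead    : Class X
  marked  : ℕ → Class X

-- A rule is consulted only when all arguments are regular. Marks pass upwards unchanged, which
-- makes the marked terms an ideal.
bind : ∀ {X Y} → Class X → (X → Class Y) → Class Y
bind (regular x) r = r x
bind dead        r = dead
bind (marked n)  r = marked n

cons : ∀ {X} → Class X → Class (List X) → Class (List X)
cons (marked m)  (marked n)   = marked (m ⊓ n)
cons (marked m)  (regular _)  = marked m
cons (marked m)  dead         = marked m
cons dead        (marked n)   = marked n
cons dead        (regular _)  = dead
cons dead        dead         = dead
cons (regular _) (marked n)   = marked n
cons (regular x) (regular xs) = regular (x ∷ xs)
cons (regular _) dead         = dead

gather : ∀ {X n} → Vec (Class X) n → Class (List X)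
gather []       = regular []
gather (k ∷ ks) = cons k (gather ks)

-- Variables count as dead, so classes can only move up under substitution.
infix 4 _⊑_

data _⊑_ {X : Set} : Class X → Class X → Set where
  dead    : ∀ {k} → dead ⊑ k
  regular : ∀ {x} → regular x ⊑ regular x
  marked  : ∀ {m n} → n ≤ m → marked m ⊑ marked n

cons-mono : ∀ {X} {k k′ : Class X} {ks ks′} → k ⊑ k′ → ks ⊑ ks′ → cons k ks ⊑ cons k′ ks′
cons-mono {k′ = marked _}  (marked p) (marked q)         = marked (ℕ.⊓-mono-≤ p q)
cons-mono                  (marked p) regular            = marked p
cons-mono {ks′ = regular _} (marked p) dead              = marked p
cons-mono {ks′ = dead}     (marked p) dead               = marked p
cons-mono {ks′ = marked n} (marked p) dead               = marked (ℕ.≤-trans (ℕ.m⊓n≤m _ n) p)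
cons-mono                  regular (marked q)            = marked q
cons-mono                  regular regular               = regular
cons-mono                  regular dead                  = dead
cons-mono {k′ = marked m}  dead (marked q)               = marked (ℕ.≤-trans (ℕ.m⊓n≤n m _) q)
cons-mono {k′ = regular _} dead (marked q)               = marked q
cons-mono {k′ = dead}      dead (marked q)               = marked q
cons-mono                  dead regular                  = dead
cons-mono                  dead dead                     = dead

bind-mono : ∀ {X Y} {k k′ : Class X} (r : X → Class Y) → k ⊑ k′ → bind k r ⊑ bind k′ r
bind-mono r dead       = dead
bind-mono r (marked p) = marked p
bind-mono {k = regular x} r regular with r x
... | regular _ = regular
... | dead      = dead
... | marked _  = marked ℕ.≤-refl

⊑-trans : ∀ {X} {k l m : Class X} → k ⊑ l → l ⊑ m → k ⊑ m
⊑-trans dead       _          = dead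
⊑-trans regular    regular    = regular
⊑-trans (marked p) (marked q) = marked (ℕ.≤-trans q p)

marked? : ∀ {X} (k : Class X) → (∃ λ n → marked n ⊑ k) ⊎ (∀ n → ¬ (marked n ⊑ k))
marked? (regular x) = inj₂ (λ _ ())
marked? dead        = inj₂ (λ _ ())
marked? (marked n)  = inj₁ (n , marked ℕ.≤-refl)

-- Term sizes and separating substitutions

module _ (S : Signature) where
  open Signature S

  op-injective : ∀ {V f} {ts us : Vec (Term S V) (arity f)} → op {V = V} f ts ≡ op f us → ts ≡ us
  op-injective refl = refl

  fold-op : ∀ {V} → (t : Term S V) → fold S var op t ≡ t
  fold-op-vec : ∀ {V n} (ts : Vec (Term S V) n) → foldVec S var op ts ≡ ts
  fold-op (var v)   = refl
  fold-op (op f ts) = cong (op f) (fold-op-vec ts)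
  fold-op-vec []       = refl
  fold-op-vec (t ∷ ts) = cong₂ _∷_ (fold-op t) (fold-op-vec ts)

  weight : ∀ {V} → ℕ → Term S V → ℕ
  weight w = fold S (λ _ → w) (λ _ ns → suc (Vec.sum ns))

  size-substitute : ∀ {V} (t : GroundTerm S) (p : Term S V) →
                    size S (substitute S (λ _ → t) p) ≡ weight (size S t) p
  sum-substitute : ∀ {V n} (t : GroundTerm S) (ps : Vec (Term S V) n) →
    Vec.sum (foldVec S (λ ()) (λ _ ns → suc (Vec.sum ns)) (foldVec S (λ _ → t) op ps)) ≡
    Vec.sum (foldVec S (λ _ → size S t) (λ _ ns → suc (Vec.sum ns)) ps)
  size-substitute t (var v)   = refl
  size-substitute t (op f ps) = cong suc (sum-substitute t ps)
  sum-substitute t []       = refl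
  sum-substitute t (p ∷ ps) = cong₂ _+_ (size-substitute t p) (sum-substitute t ps)

  -- Either no variable occurs, or a single occurrence already contributes `w`.
  constant-or-large : ∀ {V} (p : Term S V) →
    (∀ w w′ → weight w p ≡ weight w′ p) ⊎ (∀ w → w ≤ weight w p)
  sum-constant-or-large : ∀ {V n} (ps : Vec (Term S V) n) →
    let sum = λ w → Vec.sum (foldVec S (λ _ → w) (λ _ ns → suc (Vec.sum ns)) ps) in
    (∀ w w′ → sum w ≡ sum w′) ⊎ (∀ w → w ≤ sum w)
  constant-or-large (var v) = inj₂ (λ w → ℕ.≤-refl)
  constant-or-large (op f ps) with sum-constant-or-large ps
  ... | inj₁ constant = inj₁ (λ w w′ → cong suc (constant w w′))
  ... | inj₂ large    = inj₂ (λ w → ℕ.m≤n⇒m≤1+n (large w))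
  sum-constant-or-large [] = inj₁ (λ _ _ → refl)
  sum-constant-or-large (p ∷ ps) with constant-or-large p | sum-constant-or-large ps
  ... | inj₁ c     | inj₁ cs     = inj₁ (λ w w′ → cong₂ _+_ (c w w′) (cs w w′))
  ... | inj₂ large | _           = inj₂ (λ w → ℕ.m≤n⇒m≤n+o _ (large w))
  ... | inj₁ _     | inj₂ large  = inj₂ (λ w → ℕ.m≤n⇒m≤o+n _ (large w))

  module Separation (o o′ : GroundTerm S) (size≢ : size S o ≢ size S o′) where

    choose : (ℕ → Bool) → ℕ → GroundTerm S
    choose β x = if β x then o else o′

    module _ {f : Sym} {ts : Vec (Term S ℕ) (arity f)} where
      private
        p : Term S ℕ
        p = op f ts

      -- If no variable occurs in `p`, its two instances have equal size, unlike `o` and `o′`.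
      -- Otherwise the instance at `o` contains `o` below its root and is larger than `o`.
      var≢op : ¬ (o ≡ substitute S (λ _ → o) p × o′ ≡ substitute S (λ _ → o′) p)
      var≢op (eq , eq′) with sum-constant-or-large ts
      ... | inj₁ constant = size≢ (trans (sized o eq)
              (trans (cong suc (constant _ _)) (≡-sym (sized o′ eq′))))
        where
        sized : ∀ t → t ≡ substitute S (λ _ → t) p → size S t ≡ weight (size S t) p
        sized t e = trans (cong (size S) e) (size-substitute t p)
      ... | inj₂ large = ℕ.<-irrefl (trans (cong (size S) eq) (size-substitute o p)) (s≤s (large _))

    -- Distinct variables are told apart by sending only one of them to `o`, a variable and a
    -- compound term by size; compound terms are compared argument by argument.
    substitutions-separate : ∀ p q →
      (∀ β → substitute S (choose β) p ≡ substitute S (choose β) q) → p ≡ q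
    substitutions-separate-vec : ∀ {n} (ps qs : Vec (Term S ℕ) n) →
      (∀ β → foldVec S (choose β) op ps ≡ foldVec S (choose β) op qs) → ps ≡ qs
    substitutions-separate (var x) (var y) eq with x ℕ.≟ y
    ... | yes refl = refl
    ... | no x≢y   = contradiction (cong (size S) o≡o′) size≢
      where
      β : ℕ → Bool
      β z = does (z ℕ.≟ x)
      o≡o′ : o ≡ o′
      o≡o′ = begin
        o          ≡⟨ cong (λ b → if b then o else o′) (dec-true (x ℕ.≟ x) refl) ⟨
        choose β x ≡⟨ eq β ⟩
        choose β y ≡⟨ cong (λ b → if b then o else o′) (dec-false (y ℕ.≟ x) (≢-sym x≢y)) ⟩
        o′         ∎
    substitutions-separate (var x) (op f qs) eq =
      contradiction (eq (const true) , eq (const false)) var≢op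
    substitutions-separate (op f ps) (var y) eq =
      contradiction (≡-sym (eq (const true)) , ≡-sym (eq (const false))) var≢op
    substitutions-separate (op f ps) (op g qs) eq with head-≡ (eq (const true))
      where
      head-≡ : ∀ {f g ts us} → op {V = ⊥} f ts ≡ op g us → f ≡ g
      head-≡ refl = refl
    ... | refl = cong (op f) (substitutions-separate-vec ps qs (op-injective ∘ eq))
    substitutions-separate-vec []       []       eq = refl
    substitutions-separate-vec (p ∷ ps) (q ∷ qs) eq = cong₂ _∷_
      (substitutions-separate p q (λ β → ∷-injectiveˡ (eq β)))
      (substitutions-separate-vec ps qs (λ β → ∷-injectiveʳ (eq β)))

  -- The Rees quotient and its approximating congruences

  module Rees (rule : Sym → List ℕ → Class ℕ) where

    node : (f : Sym) → Vec (Class ℕ) (arity f) → Class ℕ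
    node f ks = bind (gather ks) (rule f)

    classify : ∀ {V} → Term S V → Class ℕ
    classify = fold S (λ _ → dead) node

    classifyVec : ∀ {V n} → Vec (Term S V) n → Vec (Class ℕ) n
    classifyVec = foldVec S (λ _ → dead) node

    -- Variables start at the bottom class and `node` is monotone. Hence a mark of `p` bounds the
    -- marks of all its instances uniformly.
    classify-substitute : ∀ {V W} (σ : V → Term S W) p → classify p ⊑ classify (substitute S σ p)
    gather-substitute : ∀ {V W n} (σ : V → Term S W) (ps : Vec (Term S V) n) →
      gather (classifyVec ps) ⊑ gather (classifyVec (foldVec S σ op ps))
    classify-substitute σ (var x)   = dead
    classify-substitute σ (op f ps) = bind-mono (rule f) (gather-substitute σ ps)
    gather-substitute σ []       = regular
    gather-substitute σ (p ∷ ps) = cons-mono (classify-substitute σ p) (gather-substitute σ ps)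

    -- Variables already count as dead, so dead terms in their place create no new mark.
    classify-substitute-dead : ∀ {V W} {σ : V → Term S W} → (∀ x → classify (σ x) ≡ dead) →
      ∀ p → classify (substitute S σ p) ≡ classify p
    classifyVec-substitute-dead : ∀ {V W n} {σ : V → Term S W} → (∀ x → classify (σ x) ≡ dead) →
      (ps : Vec (Term S V) n) → classifyVec (foldVec S σ op ps) ≡ classifyVec ps
    classify-substitute-dead d (var x)   = d x
    classify-substitute-dead d (op f ps) = cong (node f) (classifyVec-substitute-dead d ps)
    classifyVec-substitute-dead d []       = refl
    classifyVec-substitute-dead d (p ∷ ps) =
      cong₂ _∷_ (classify-substitute-dead d p) (classifyVec-substitute-dead d ps)

    infix 4 _≈[_]_ _≈_

    -- As smaller marks are higher in the order, `marked N ⊑ classify u` says that the mark of `u`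
    -- is at most `N`.
    _≈[_]_ : GroundTerm S → ℕ → GroundTerm S → Set
    u ≈[ N ] t = u ≡ t ⊎ (marked N ⊑ classify u × marked N ⊑ classify t)

    ≈[]-sym : ∀ {N u t} → u ≈[ N ] t → t ≈[ N ] u
    ≈[]-sym (inj₁ u≡t)     = inj₁ (≡-sym u≡t)
    ≈[]-sym (inj₂ (p , q)) = inj₂ (q , p)

    ≈[]-trans : ∀ {N u t s} → u ≈[ N ] t → t ≈[ N ] s → u ≈[ N ] s
    ≈[]-trans (inj₁ refl)    q              = q
    ≈[]-trans (inj₂ p)       (inj₁ refl)    = inj₂ p
    ≈[]-trans (inj₂ (p , _)) (inj₂ (_ , q)) = inj₂ (p , q)

    ≈[]-mono : ∀ {M N u t} → M ≤ N → u ≈[ M ] t → u ≈[ N ] t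
    ≈[]-mono M≤N (inj₁ u≡t)     = inj₁ u≡t
    ≈[]-mono M≤N (inj₂ (p , q)) = inj₂ (⊑-trans (marked M≤N) p , ⊑-trans (marked M≤N) q)

    ≈[]-cong : ∀ {N} f {us ts} → Pointwise (_≈[ N ]_) us ts → op f us ≈[ N ] op f ts
    ≈[]-cong {N} f us≈ts with componentwise us≈ts
      where
      componentwise : ∀ {n} {us ts : Vec (GroundTerm S) n} → Pointwise (_≈[ N ]_) us ts →
        us ≡ ts ⊎ (marked N ⊑ gather (classifyVec us) × marked N ⊑ gather (classifyVec ts))
      componentwise [] = inj₁ refl
      -- `cons (marked N) dead` computes to `marked N`, and `dead` lies below whatever the remaining
      -- arguments give.
      componentwise (inj₂ (p , q) ∷ _) = inj₂ (cons-mono p dead , cons-mono q dead)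
      componentwise (inj₁ refl ∷ us≈ts) with componentwise us≈ts
      ... | inj₁ refl    = inj₁ refl
      ... | inj₂ (p , q) = inj₂ (cons-mono dead p , cons-mono dead q)
    ... | inj₁ refl    = inj₁ refl
    ... | inj₂ (p , q) = inj₂ (bind-mono (rule f) p , bind-mono (rule f) q)

    _≈_ : GroundTerm S → GroundTerm S → Set
    u ≈ t = ∃ λ N → u ≈[ N ] t

    -- An operation has finitely many arguments, so their bounds have a common maximum.
    ≈-cong : ∀ f {us ts} → Pointwise _≈_ us ts → op f us ≈ op f ts
    ≈-cong f us≈ts = map₂ (≈[]-cong f) (common-bound us≈ts)
      where
      common-bound : ∀ {n} {us ts : Vec (GroundTerm S) n} →
                     Pointwise _≈_ us ts → ∃ λ N → Pointwise (_≈[ N ]_) us ts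
      common-bound [] = 0 , []
      common-bound ((M , u≈t) ∷ us≈ts) with common-bound us≈ts
      ... | N , us≈ts′ = M ⊔ N ,
        ≈[]-mono (ℕ.m≤m⊔n M N) u≈t ∷ Pointwise.map (≈[]-mono (ℕ.m≤n⊔m M N)) us≈ts′

    reesQuotient : Algebra S
    reesQuotient = record
      { setoid = record
        { Carrier = GroundTerm S
        ; _≈_     = _≈_
        ; isEquivalence = record
          { refl  = 0 , inj₁ refl
          ; sym   = map₂ ≈[]-sym
          ; trans = λ { (M , p) (N , q) →
              M ⊔ N , ≈[]-trans (≈[]-mono (ℕ.m≤m⊔n M N) p) (≈[]-mono (ℕ.m≤n⊔m M N) q) }
          }
        }
      ; ⟦_⟧     = op
      ; ⟦⟧-cong = ≈-cong
      }

    value-id : ∀ t → value S reesQuotient t ≡ t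
    valueVec-id : ∀ {n} (ts : Vec (GroundTerm S) n) → foldVec S (λ ()) op ts ≡ ts
    value-id (op f ts) = cong (op f) (valueVec-id ts)
    valueVec-id []       = refl
    valueVec-id (t ∷ ts) = cong₂ _∷_ (value-id t) (valueVec-id ts)

    generated : GeneratedByConstants S reesQuotient
    generated t = t , 0 , inj₁ (value-id t)

    ⊨⇒≈ : ∀ u t → _⊨_≈_ S reesQuotient u t → u ≈ t
    ⊨⇒≈ u t = subst₂ _≈_ (value-id u) (value-id t)

    ≈⇒⊨ : ∀ u t → u ≈ t → _⊨_≈_ S reesQuotient u t
    ≈⇒⊨ u t = subst₂ _≈_ (≡-sym (value-id u)) (≡-sym (value-id t))

    -- Finite sets of equations and non-initiality

    Bounds : List (Equation S) → ℕ → Set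
    Bounds Γ N = ∀ {p q} → (p , q) ∈ Γ → ∀ σ → substitute S σ p ≈[ N ] substitute S σ q

    -- Each `≈[ N ]` is a congruence, so it contains the congruence generated by the instances it
    -- contains.
    bounded-derivations : ∀ {Γ N} → Bounds Γ N → ∀ {u t} → _⊢_∼_ S Γ u t → u ≈[ N ] t
    bounded-derivations-vec : ∀ {Γ N} → Bounds Γ N → ∀ {n} {us ts : Vec (GroundTerm S) n} →
      Pointwise (_⊢_∼_ S Γ) us ts → Pointwise (_≈[ N ]_) us ts
    bounded-derivations b (instance-of p∈Γ σ) = b p∈Γ σ
    bounded-derivations b ∼-refl              = inj₁ refl
    bounded-derivations b (∼-sym d)           = ≈[]-sym (bounded-derivations b d)
    bounded-derivations b (∼-trans d e)       = ≈[]-trans (bounded-derivations b d) (bounded-derivations b e)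
    bounded-derivations b (∼-cong f ds)       = ≈[]-cong f (bounded-derivations-vec b ds)
    bounded-derivations-vec b []       = []
    bounded-derivations-vec b (d ∷ ds) = bounded-derivations b d ∷ bounded-derivations-vec b ds

    module _ (Γ : List (Equation S)) (iso : _≅_ S reesQuotient (𝓕/ S Γ)) where
      open _≅_ iso using (homo; inverse)
      open Inverse inverse using (to; to-cong; inverseʳ)

      -- A homomorphism is determined on ground terms. An arbitrary isomorphism therefore forces `≈`
      -- and derivability from `Γ` to coincide.
      to-id : ∀ t → _⊢_∼_ S Γ (to t) t
      to-id-vec : ∀ {n} (ts : Vec (GroundTerm S) n) → Pointwise (_⊢_∼_ S Γ) (Vec.map to ts) ts
      to-id (op f ts) = ∼-trans (homo f ts) (∼-cong f (to-id-vec ts))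
      to-id-vec []       = []
      to-id-vec (t ∷ ts) = to-id t ∷ to-id-vec ts

      ≈⇒⊢ : ∀ {u t} → u ≈ t → _⊢_∼_ S Γ u t
      ≈⇒⊢ u≈t = ∼-trans (∼-sym (to-id _)) (∼-trans (to-cong u≈t) (to-id _))

      ⊢⇒≈ : ∀ {u t} → _⊢_∼_ S Γ u t → u ≈ t
      -- Both `u` and `t` are equivalent to the image of `to u` under the inverse map.
      ⊢⇒≈ u∼t = ≈.trans (≈.sym (inverseʳ ∼-refl))
        (inverseʳ (∼-trans (to-id _) (∼-trans u∼t (∼-sym (to-id _)))))
        where module ≈ = Algebra reesQuotient

    module NonInitial
      {o o′ : GroundTerm S} (size≢ : size S o ≢ size S o′)
      (o-dead : classify o ≡ dead) (o′-dead : classify o′ ≡ dead)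
      (τ : ℕ → GroundTerm S) (τ-marked : ∀ n → classify (τ n) ≡ marked n)
      where

      open Separation o o′ size≢

      choose-dead : ∀ β x → classify (choose β x) ≡ dead
      choose-dead β x with β x
      ... | true  = o-dead
      ... | false = o′-dead

      -- If p is unmarked then so are its instances under dead substitutions,
      -- so p and q agree on these and hence coincide.
      unmarked⇒≡ : ∀ (p q : Term S ℕ) → (∀ n → ¬ (marked n ⊑ classify p)) →
        (∀ σ → substitute S σ p ≈ substitute S σ q) → p ≡ q
      unmarked⇒≡ p q unmarked valid = substitutions-separate p q agree
        where
        agree : ∀ β → substitute S (choose β) p ≡ substitute S (choose β) q
        agree β with valid (choose β)
        ... | N , inj₁ eq      = eq
        ... | N , inj₂ (m , _) = contradiction
          (subst (marked N ⊑_) (classify-substitute-dead (choose-dead β) p) m) (unmarked N)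

      -- The bound has to be independent of `σ`. If one side is unmarked the two sides are the same
      -- term; otherwise their own marks persist in every instance, and the larger one serves.
      valid⇒bounded : ∀ (p q : Term S ℕ) → (∀ σ → substitute S σ p ≈ substitute S σ q) →
        ∃ λ N → ∀ σ → substitute S σ p ≈[ N ] substitute S σ q
      valid⇒bounded p q valid with marked? (classify p) | marked? (classify q)
      ... | inj₂ ¬m | _ = 0 , λ σ → inj₁ (cong (substitute S σ) (unmarked⇒≡ p q ¬m valid))
      ... | _ | inj₂ ¬m = 0 , λ σ → inj₁ (cong (substitute S σ)
            (≡-sym (unmarked⇒≡ q p ¬m (map₂ ≈[]-sym ∘ valid))))
      ... | inj₁ (M , m) | inj₁ (N , n) = M ⊔ N , λ σ → inj₂
            ( ⊑-trans (marked (ℕ.m≤m⊔n M N)) (⊑-trans m (classify-substitute σ p))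
            , ⊑-trans (marked (ℕ.m≤n⊔m M N)) (⊑-trans n (classify-substitute σ q)) )

      -- Finiteness of `Γ` enters here: the bounds of its equations have a maximum.
      common-bound : ∀ Γ → (∀ {p q} → (p , q) ∈ Γ → ∀ σ → substitute S σ p ≈ substitute S σ q) →
                     ∃ (Bounds Γ)
      common-bound []            valid = 0 , λ ()
      common-bound ((p , q) ∷ Γ) valid
        with valid⇒bounded p q (valid (here refl)) | common-bound Γ (valid ∘ there)
      ... | M , b | N , bs = M ⊔ N , λ
        { (here refl) σ → ≈[]-mono (ℕ.m≤m⊔n M N) (b σ)
        ; (there p∈Γ) σ → ≈[]-mono (ℕ.m≤n⊔m M N) (bs p∈Γ σ)
        }

      τ-≈ : ∀ m n → τ m ≈ τ n
      τ-≈ m n = m ⊔ n , inj₂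
        ( subst (marked (m ⊔ n) ⊑_) (≡-sym (τ-marked m)) (marked (ℕ.m≤m⊔n m n))
        , subst (marked (m ⊔ n) ⊑_) (≡-sym (τ-marked n)) (marked (ℕ.m≤n⊔m m n)) )

      -- The mark of `τ (suc N)` exceeds `N`, so `≈[ N ]` does not collapse it, and `τ 0` is a
      -- different term because its mark differs.
      τ-≉ : ∀ N → ¬ (τ 0 ≈[ N ] τ (suc N))
      τ-≉ N (inj₁ eq) with trans (≡-sym (τ-marked 0)) (trans (cong classify eq) (τ-marked (suc N)))
      ... | ()
      τ-≉ N (inj₂ (_ , m)) with subst (marked N ⊑_) (τ-marked (suc N)) m
      ... | marked N<N = ℕ.<-irrefl refl N<N

      nonInitial : ¬ Initial S reesQuotient
      nonInitial (Γ , iso) with common-bound Γ (λ p∈Γ σ → ⊢⇒≈ Γ iso (instance-of p∈Γ σ))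
      ... | N , bounds = τ-≉ N (bounded-derivations bounds (≈⇒⊢ Γ iso (τ-≈ 0 (suc N))))

    -- Polish notation and unique readability

    symbols : GroundTerm S → List Sym
    symbolsVec : ∀ {n} → Vec (GroundTerm S) n → List Sym
    symbols (op f ts) = f ∷ symbolsVec ts
    symbolsVec []       = []
    symbolsVec (t ∷ ts) = symbols t ++ symbolsVec ts

    polish-symbols : ∀ t → polish S t ≡ map Letter.sym (symbols t)
    polish-symbolsVec : ∀ {n} (ts : Vec (GroundTerm S) n) →
      concat (toList (foldVec S {X = List (Letter S)} (λ ()) (λ f ws → Letter.sym f ∷ concat (toList ws)) ts)) ≡
      map Letter.sym (symbolsVec ts)
    polish-symbols (op f ts) = cong (Letter.sym f ∷_) (polish-symbolsVec ts)
    polish-symbolsVec []       = refl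
    polish-symbolsVec (t ∷ ts) = trans (cong₂ _++_ (polish-symbols t) (polish-symbolsVec ts))
      (≡-sym (map-++ Letter.sym (symbols t) (symbolsVec ts)))

    length-symbols : ∀ t → length (symbols t) ≡ size S t
    length-symbolsVec : ∀ {n} (ts : Vec (GroundTerm S) n) →
      length (symbolsVec ts) ≡ Vec.sum (foldVec S (λ ()) (λ _ ns → suc (Vec.sum ns)) ts)
    length-symbols (op f ts) = cong suc (length-symbolsVec ts)
    length-symbolsVec []       = refl
    length-symbolsVec (t ∷ ts) = trans (length-++ (symbols t))
      (cong₂ _+_ (length-symbols t) (length-symbolsVec ts))

    -- Arities determine where a term ends. The remainders `r` and `s` are carried along so that the
    -- induction can pass from one argument to the next.
    unique-reading : ∀ u t {r s} → symbols u ++ r ≡ symbols t ++ s → u ≡ t × r ≡ s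
    unique-reading-vec : ∀ {n} (us ts : Vec (GroundTerm S) n) {r s} →
      symbolsVec us ++ r ≡ symbolsVec ts ++ s → us ≡ ts × r ≡ s
    unique-reading (op f us) (op g ts) eq with ∷-injective eq
    ... | refl , eq′ = map₁ (cong (op f)) (unique-reading-vec us ts eq′)
    unique-reading-vec []       []       eq = refl , eq
    unique-reading-vec (u ∷ us) (t ∷ ts) {r} {s} eq
      with unique-reading u t (trans (≡-sym (++-assoc (symbols u) _ r))
             (trans eq (++-assoc (symbols t) _ s)))
    ... | refl , eq′ = map₁ (cong (u ∷_)) (unique-reading-vec us ts eq′)

    symbols-injective : ∀ {u t} → symbols u ≡ symbols t → u ≡ t
    symbols-injective {u} {t} eq = proj₁ (unique-reading u t (cong (_++ []) eq))

-- Automata on Polish notation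

module Effect {k : ℕ} (idle : Fin k) (link : Fin k → ℕ → Maybe (Fin k)) where

  -- The state after reading a whole term from `q`. Proper subterms of any `τ n` are regular, so a
  -- dead term breaks off every partial occurrence.
  effect : Fin k → Class ℕ → Maybe (Fin k)
  effect q (regular n) = link q n
  effect q dead        = just idle
  effect q (marked _)  = nothing

  effects : ∀ {n} → Fin k → Vec (Class ℕ) n → Maybe (Fin k)
  effects q []       = just q
  effects q (c ∷ cs) = effect q c >>= λ q′ → effects q′ cs

  -- From `idle` only a marked argument changes the state. This settles the symbols whose rule
  -- always yields `dead`.
  effects-idle : (∀ n → link idle n ≡ just idle) →
    ∀ {q n} (cs : Vec (Class ℕ) n) → effects idle cs ≡ effect q (bind (gather cs) (λ _ → dead))
  effects-idle eq [] = refl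
  effects-idle eq (marked _ ∷ cs) with gather cs
  ... | regular _ = refl
  ... | dead      = refl
  ... | marked _  = refl
  effects-idle eq {q} (dead ∷ cs) with gather cs | effects-idle eq {q} cs
  ... | regular _ | ih = ih
  ... | dead      | ih = ih
  ... | marked _  | ih = ih
  effects-idle eq {q} (regular n ∷ cs) rewrite eq n with gather cs | effects-idle eq {q} cs
  ... | regular _ | ih = ih
  ... | dead      | ih = ih
  ... | marked _  | ih = ih

-- A finite automaton reading Polish notation symbol by symbol (nothing is the
-- absorbing accepting state), such that the effect of reading a whole term
-- depends only on the class of that term.
record Recogniser (Role : Set) : Set₁ where
  field
    rule  : Role → List ℕ → Class ℕ
    Fits  : Role → ℕ → Set
    {k}   : ℕ
    idle  : Fin k
    move  : Fin k → Role → Maybe (Fin k)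
    link  : Fin k → ℕ → Maybe (Fin k)

  open Effect idle link public

  field
    idle-link     : ∀ n → link idle n ≡ just idle
    compositional : ∀ r {n} → Fits r n → ∀ q (cs : Vec (Class ℕ) n) →
      (move q r >>= λ q′ → effects q′ cs) ≡ effect q (bind (gather cs) (rule r))

-- Deciding the word problem

module Decision
  (S : Signature) (_≟_ : DecidableEquality (Signature.Sym S))
  {Role : Set} (R : Recogniser Role)
  (role : Signature.Sym S → Role)
  (fits : ∀ f → Recogniser.Fits R (role f) (Signature.arity S f))
  where

  open Signature S
  open Recogniser R
  open Rees S (rule ∘ role) public

  advance : Maybe (Fin k) → Sym → Maybe (Fin k)
  advance m f = m >>= λ q → move q (role f)

  open Comparison S _≟_ (just idle) advance is-nothing

  advance-nothing : ∀ w → foldl advance nothing w ≡ nothing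
  advance-nothing []      = refl
  advance-nothing (_ ∷ w) = advance-nothing w

  advance-symbols : ∀ q t → foldl advance (just q) (symbols t) ≡ effect q (classify t)
  advance-symbolsVec : ∀ {n} q (ts : Vec (GroundTerm S) n) →
    foldl advance (just q) (symbolsVec ts) ≡ effects q (classifyVec ts)
  advance-symbols q (op f ts) = trans after-head (compositional (role f) (fits f) q (classifyVec ts))
    where
    after-head : foldl advance (move q (role f)) (symbolsVec ts) ≡
            (move q (role f) >>= λ q′ → effects q′ (classifyVec ts))
    after-head with move q (role f)
    ... | just q′ = advance-symbolsVec q′ ts
    ... | nothing = advance-nothing (symbolsVec ts)
  advance-symbolsVec q []       = refl
  advance-symbolsVec q (t ∷ ts) = begin
    foldl advance (just q) (symbols t ++ symbolsVec ts)
      ≡⟨ foldl-++ advance (just q) (symbols t) (symbolsVec ts) ⟩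
    foldl advance (foldl advance (just q) (symbols t)) (symbolsVec ts)
      ≡⟨ cong (λ m → foldl advance m (symbolsVec ts)) (advance-symbols q t) ⟩
    foldl advance (effect q (classify t)) (symbolsVec ts)
      ≡⟨ continue (effect q (classify t)) ⟩
    (effect q (classify t) >>= λ q′ → effects q′ (classifyVec ts)) ∎
    where
    continue : ∀ m → foldl advance m (symbolsVec ts) ≡ (m >>= λ q′ → effects q′ (classifyVec ts))
    continue (just q′) = advance-symbolsVec q′ ts
    continue nothing   = advance-nothing (symbolsVec ts)

  polynomialTime : PolynomialTimeWordProblem S reesQuotient
  polynomialTime = machine , 3 , 1 , λ u t → verdict (symbols u) (symbols t) , halts u t , correct u t
    where
    halts : ∀ u t → run machine (3 * (size S u + size S t) ^ 1 + 3) (initial machine (encode S u t)) ≡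
                    just (verdict (symbols u) (symbols t))
    halts u t rewrite ≡-sym (length-symbols u) | ≡-sym (length-symbols t)
                    | polish-symbols u | polish-symbols t = machine-run (symbols u) (symbols t)

    marked-accepted : ∀ {n} t → marked n ⊑ classify t → is-nothing (final (symbols t)) ≡ true
    marked-accepted t m rewrite advance-symbols idle t with classify t | m
    ... | marked _ | _ = refl

    unmarked-rejected : ∀ t → (∀ n → ¬ (marked n ⊑ classify t)) → is-nothing (final (symbols t)) ≡ false
    unmarked-rejected t ¬m rewrite advance-symbols idle t with classify t
    ... | marked n  = contradiction (marked ℕ.≤-refl) (¬m n)
    ... | dead      = refl
    ... | regular n = cong is-nothing (idle-link n)

    -- A marked `u` is equivalent exactly to the marked terms, an unmarked one only to itself; in
    -- the latter case unique readability reduces equality of terms to equality of words.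
    correct : ∀ u t → Reflects (_⊨_≈_ S reesQuotient u t) (verdict (symbols u) (symbols t))
    correct u t with marked? (classify u)
    correct u t | inj₁ (m , mu) rewrite marked-accepted u mu with marked? (classify t)
    ... | inj₁ (n , mt) rewrite marked-accepted t mt = ofʸ (≈⇒⊨ u t (m ⊔ n , inj₂
            (⊑-trans (marked (ℕ.m≤m⊔n m n)) mu , ⊑-trans (marked (ℕ.m≤n⊔m m n)) mt)))
    ... | inj₂ ¬mt rewrite unmarked-rejected t ¬mt = ofⁿ (differ ∘ ⊨⇒≈ u t)
      where
      differ : ¬ (u ≈ t)
      differ (_ , inj₁ refl)     = ¬mt m mu
      differ (N , inj₂ (_ , mt)) = ¬mt N mt
    correct u t | inj₂ ¬mu rewrite unmarked-rejected u ¬mu with ≡-dec _≟_ (symbols u) (symbols t)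
    ... | yes eq = ofʸ (≈⇒⊨ u t (0 , inj₁ (symbols-injective eq)))
    ... | no neq = ofⁿ (differ ∘ ⊨⇒≈ u t)
      where
      differ : ¬ (u ≈ t)
      differ (_ , inj₁ refl)     = neq refl
      differ (N , inj₂ (mu , _)) = ¬mu N mu

  -- The arity is known only up to a propositional equality, along which the arguments are
  -- transported.
  apply : ∀ f {n} → arity f ≡ n → Vec (GroundTerm S) n → GroundTerm S
  apply f e ts = op f (subst (Vec _) (≡-sym e) ts)

  classify-apply : ∀ {f r n cs} (e : arity f ≡ n) (ts : Vec (GroundTerm S) n) → role f ≡ r →
    classifyVec ts ≡ cs → classify (apply f e ts) ≡ bind (gather cs) (rule r)
  classify-apply {f} e ts refl refl = cong (λ c → bind c (rule (role f))) (transport e)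
    where
    transport : ∀ {m} (e : m ≡ _) →
      gather (classifyVec (subst (Vec _) (≡-sym e) ts)) ≡ gather (classifyVec ts)
    transport refl = refl

  size-apply : ∀ {f n} (e : arity f ≡ n) (ts : Vec (GroundTerm S) n) →
    size S (apply f e ts) ≡ suc (Vec.sum (Vec.map (size S) ts))
  size-apply e ts = cong suc (transport e ts)
    where
    transport : ∀ {m n} (e : m ≡ n) (ts : Vec (GroundTerm S) n) →
      Vec.sum (foldVec S (λ ()) (λ _ ns → suc (Vec.sum ns)) (subst (Vec _) (≡-sym e) ts)) ≡
      Vec.sum (Vec.map (size S) ts)
    transport refl []       = refl
    transport refl (t ∷ ts) = cong (size S t +_) (transport refl ts)

-- Signatures with two unary symbols

module Unary where

  data Role : Set where
    base spine top other : Role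

  -- Marking starts at `f (g c)`, so that `f c` stays dead and can serve as a separating term.
  rule : Role → List ℕ → Class ℕ
  rule base  []           = regular 0
  rule spine (n ∷ [])     = regular (suc n)
  rule top   (suc n ∷ []) = marked n
  rule _     _            = dead

  Fits : Role → ℕ → Set
  Fits base  n = n ≡ 0
  Fits spine n = n ≡ 1
  Fits top   n = n ≡ 1
  Fits other n = ⊤

  -- The states record the longest suffix read so far that may begin f gⁿ c with n ≥ 1
  -- (f for top, g for spine, c for base): 0F none, 1F f, 2F f gⁿ with n ≥ 1.
  move : Fin 3 → Role → Maybe (Fin 3)
  move _  top   = just 1F
  move _  other = just 0F
  move 0F spine = just 0F
  move 1F spine = just 2F
  move 2F spine = just 2F
  move 0F base  = just 0F
  move 1F base  = just 0F
  move 2F base  = nothing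

  -- The state in which `move` ends after reading gⁿ c.
  link : Fin 3 → ℕ → Maybe (Fin 3)
  link 0F _       = just 0F
  link 1F 0       = just 0F
  link 1F (suc _) = nothing
  link 2F _       = nothing

  open Effect 0F link

  compositional : ∀ r {n} → Fits r n → ∀ q (cs : Vec (Class ℕ) n) →
    (move q r >>= λ q′ → effects q′ cs) ≡ effect q (bind (gather cs) (rule r))
  compositional base  refl 0F []                    = refl
  compositional base  refl 1F []                    = refl
  compositional base  refl 2F []                    = refl
  compositional spine refl 0F (regular _ ∷ [])      = refl
  compositional spine refl 1F (regular _ ∷ [])      = refl
  compositional spine refl 2F (regular _ ∷ [])      = refl
  compositional spine refl 0F (dead ∷ [])           = refl
  compositional spine refl 1F (dead ∷ [])           = refl
  compositional spine refl 2F (dead ∷ [])           = refl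
  compositional spine refl 0F (marked _ ∷ [])       = refl
  compositional spine refl 1F (marked _ ∷ [])       = refl
  compositional spine refl 2F (marked _ ∷ [])       = refl
  compositional top   refl _  (regular 0 ∷ [])      = refl
  compositional top   refl _  (regular (suc _) ∷ []) = refl
  compositional top   refl _  (dead ∷ [])           = refl
  compositional top   refl _  (marked _ ∷ [])       = refl
  compositional other _    _  cs                    = effects-idle (λ _ → refl) cs

  recogniser : Recogniser Role
  recogniser = record
    { rule = rule ; Fits = Fits ; idle = 0F ; move = move ; link = link
    ; idle-link = λ _ → refl ; compositional = compositional }

  module Construction
    (S : Signature) (_≟_ : DecidableEquality (Signature.Sym S)) {c f g : Signature.Sym S}
    (c-nullary : Signature.arity S c ≡ 0)
    (f-unary : Signature.arity S f ≡ 1) (g-unary : Signature.arity S g ≡ 1) (f≢g : f ≢ g)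
    where

    open Signature S

    role : Sym → Role
    role s = if does (s ≟ c) then base else if does (s ≟ f) then top
             else if does (s ≟ g) then spine else other

    fits : ∀ s → Fits (role s) (arity s)
    fits s with s ≟ c | s ≟ f | s ≟ g
    ... | yes refl | _        | _        = c-nullary
    ... | no _     | yes refl | _        = f-unary
    ... | no _     | no _     | yes refl = g-unary
    ... | no _     | no _     | no _     = tt

    unary≢c : ∀ {s} → arity s ≡ 1 → s ≢ c
    unary≢c s-unary refl with trans (≡-sym s-unary) c-nullary
    ... | ()

    role-c : role c ≡ base
    role-c rewrite dec-true (c ≟ c) refl = refl

    role-f : role f ≡ top
    role-f rewrite dec-false (f ≟ c) (unary≢c f-unary) | dec-true (f ≟ f) refl = refl

    role-g : role g ≡ spine
    role-g rewrite dec-false (g ≟ c) (unary≢c g-unary) | dec-false (g ≟ f) (≢-sym f≢g)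
                 | dec-true (g ≟ g) refl = refl

    open Decision S _≟_ recogniser role fits public

    F : GroundTerm S → GroundTerm S
    F t = apply f f-unary (t ∷ [])

    chain : ℕ → GroundTerm S
    chain 0       = apply c c-nullary []
    chain (suc n) = apply g g-unary (chain n ∷ [])

    classify-chain : ∀ n → classify (chain n) ≡ regular n
    classify-chain 0       = classify-apply c-nullary [] role-c refl
    classify-chain (suc n) = classify-apply g-unary _ role-g (cong (_∷ []) (classify-chain n))

    classify-F : ∀ {t k} → classify t ≡ k → classify (F t) ≡ bind (gather (k ∷ [])) (rule top)
    classify-F eq = classify-apply f-unary _ role-f (cong (_∷ []) eq)

    nonInitial : ¬ Initial S reesQuotient
    -- The separating terms are `f c` and `f (f c)`, the second larger by one symbol.
    nonInitial = NonInitial.nonInitial {o = F (chain 0)} {o′ = F (F (chain 0))}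
      (λ eq → ℕ.<⇒≢ (s≤s (ℕ.m≤m+n _ 0)) (trans eq (size-apply f-unary _)))
      (classify-F (classify-chain 0)) (classify-F (classify-F (classify-chain 0)))
      (λ n → F (chain (suc n))) (λ n → classify-F (classify-chain (suc n)))

-- Signatures with a binary symbol

module Binary where

  data Role : Set where
    base pair other : Role

  -- The term b(c, c) is g c and must be regular; marking b(x, c) only for chains `x` of positive
  -- length keeps the clauses disjoint.
  rule : Role → List ℕ → Class ℕ
  rule base []               = regular 0
  rule pair (0 ∷ n ∷ [])     = regular (suc n)
  rule pair (suc n ∷ 0 ∷ []) = marked n
  rule _    _                = dead

  Fits : Role → ℕ → Set
  Fits base  n = n ≡ 0
  Fits pair  n = n ≡ 2
  Fits other n = ⊤

  -- With b for pair and c for base, a marked subterm is written b(bc)ⁿcc with n ≥ 1.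
  -- The states record the longest suffix read so far that may begin it:
  -- 0F none, 1F b, 2F b(bc)ⁿb with n ≥ 0, 3F b(bc)ⁿ with n ≥ 1, 4F b(bc)ⁿc with n ≥ 1.
  move : Fin 5 → Role → Maybe (Fin 5)
  move _  other = just 0F
  move 0F pair  = just 1F
  move 1F pair  = just 2F
  move 2F pair  = just 2F
  move 3F pair  = just 2F
  move 4F pair  = just 1F
  move 0F base  = just 0F
  move 1F base  = just 0F
  move 2F base  = just 3F
  move 3F base  = just 4F
  move 4F base  = nothing

  -- The state in which `move` ends after reading gⁿ c, that is, the word (bc)ⁿc.
  link : Fin 5 → ℕ → Maybe (Fin 5)
  link 0F _       = just 0F
  link 1F 0       = just 0F
  link 1F (suc _) = just 4F
  link 2F 0       = just 3F
  link 2F (suc _) = just 4F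
  link 3F _       = just 4F
  link 4F 0       = nothing
  link 4F (suc _) = just 0F

  open Effect 0F link

  -- Serves `0F` and `4F`, where reading b starts a fresh attempt at a match.
  effects-1F : ∀ q → (∀ n → link q (suc n) ≡ just 0F) → (cs : Vec (Class ℕ) 2) →
    effects 1F cs ≡ effect q (bind (gather cs) (rule pair))
  effects-1F _ eq (regular 0 ∷ regular n ∷ [])         = ≡-sym (eq n)
  effects-1F _ _  (regular 0 ∷ dead ∷ [])              = refl
  effects-1F _ _  (regular 0 ∷ marked _ ∷ [])          = refl
  effects-1F _ _  (regular (suc _) ∷ regular 0 ∷ [])   = refl
  effects-1F _ _  (regular (suc _) ∷ regular (suc _) ∷ []) = refl
  effects-1F _ _  (regular (suc _) ∷ dead ∷ [])        = refl
  effects-1F _ _  (regular (suc _) ∷ marked _ ∷ [])    = refl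
  effects-1F _ _  (dead ∷ regular _ ∷ [])              = refl
  effects-1F _ _  (dead ∷ dead ∷ [])                   = refl
  effects-1F _ _  (dead ∷ marked _ ∷ [])               = refl
  effects-1F _ _  (marked _ ∷ regular _ ∷ [])          = refl
  effects-1F _ _  (marked _ ∷ dead ∷ [])               = refl
  effects-1F _ _  (marked _ ∷ marked _ ∷ [])           = refl

  -- Serves `1F`, `2F` and `3F`, where the b just read may continue a match or, together with a
  -- preceding b, begin one.
  effects-2F : ∀ q → (∀ n → link q (suc n) ≡ just 4F) → (cs : Vec (Class ℕ) 2) →
    effects 2F cs ≡ effect q (bind (gather cs) (rule pair))
  effects-2F _ eq (regular 0 ∷ regular n ∷ [])         = ≡-sym (eq n)
  effects-2F _ _  (regular 0 ∷ dead ∷ [])              = refl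
  effects-2F _ _  (regular 0 ∷ marked _ ∷ [])          = refl
  effects-2F _ _  (regular (suc _) ∷ regular 0 ∷ [])   = refl
  effects-2F _ _  (regular (suc _) ∷ regular (suc _) ∷ []) = refl
  effects-2F _ _  (regular (suc _) ∷ dead ∷ [])        = refl
  effects-2F _ _  (regular (suc _) ∷ marked _ ∷ [])    = refl
  effects-2F _ _  (dead ∷ regular _ ∷ [])              = refl
  effects-2F _ _  (dead ∷ dead ∷ [])                   = refl
  effects-2F _ _  (dead ∷ marked _ ∷ [])               = refl
  effects-2F _ _  (marked _ ∷ regular _ ∷ [])          = refl
  effects-2F _ _  (marked _ ∷ dead ∷ [])               = refl
  effects-2F _ _  (marked _ ∷ marked _ ∷ [])           = refl

  compositional : ∀ r {n} → Fits r n → ∀ q (cs : Vec (Class ℕ) n) →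
    (move q r >>= λ q′ → effects q′ cs) ≡ effect q (bind (gather cs) (rule r))
  compositional base  refl 0F [] = refl
  compositional base  refl 1F [] = refl
  compositional base  refl 2F [] = refl
  compositional base  refl 3F [] = refl
  compositional base  refl 4F [] = refl
  compositional pair  refl 0F cs = effects-1F 0F (λ _ → refl) cs
  compositional pair  refl 1F cs = effects-2F 1F (λ _ → refl) cs
  compositional pair  refl 2F cs = effects-2F 2F (λ _ → refl) cs
  compositional pair  refl 3F cs = effects-2F 3F (λ _ → refl) cs
  compositional pair  refl 4F cs = effects-1F 4F (λ _ → refl) cs
  compositional other _    _  cs = effects-idle (λ _ → refl) cs

  recogniser : Recogniser Role
  recogniser = record
    { rule = rule ; Fits = Fits ; idle = 0F ; move = move ; link = link
    ; idle-link = λ _ → refl ; compositional = compositional }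

  module Construction
    (S : Signature) (_≟_ : DecidableEquality (Signature.Sym S)) {c b : Signature.Sym S}
    (c-nullary : Signature.arity S c ≡ 0) (b-binary : Signature.arity S b ≡ 2)
    where

    open Signature S

    role : Sym → Role
    role s = if does (s ≟ c) then base else if does (s ≟ b) then pair else other

    fits : ∀ s → Fits (role s) (arity s)
    fits s with s ≟ c | s ≟ b
    ... | yes refl | _        = c-nullary
    ... | no _     | yes refl = b-binary
    ... | no _     | no _     = tt

    b≢c : b ≢ c
    b≢c refl with trans (≡-sym b-binary) c-nullary
    ... | ()

    role-c : role c ≡ base
    role-c rewrite dec-true (c ≟ c) refl = refl

    role-b : role b ≡ pair
    role-b rewrite dec-false (b ≟ c) b≢c | dec-true (b ≟ b) refl = refl

    open Decision S _≟_ recogniser role fits public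

    B : GroundTerm S → GroundTerm S → GroundTerm S
    B t u = apply b b-binary (t ∷ u ∷ [])

    chain : ℕ → GroundTerm S
    chain 0       = apply c c-nullary []
    chain (suc n) = B (chain 0) (chain n)

    classify-B : ∀ {t u k l} → classify t ≡ k → classify u ≡ l →
      classify (B t u) ≡ bind (gather (k ∷ l ∷ [])) (rule pair)
    classify-B eq eq′ = classify-apply b-binary _ role-b (cong₂ (λ k l → k ∷ l ∷ []) eq eq′)

    classify-chain : ∀ n → classify (chain n) ≡ regular n
    classify-chain 0       = classify-apply c-nullary [] role-c refl
    classify-chain (suc n) = classify-B (classify-chain 0) (classify-chain n)

    -- With chains of positive length on both sides, neither clause of `rule` for `pair` that gives
    -- a regular or marked class applies.
    D : GroundTerm S
    D = B (chain 1) (chain 1)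

    D-dead : classify D ≡ dead
    D-dead = classify-B (classify-chain 1) (classify-chain 1)

    nonInitial : ¬ Initial S reesQuotient
    nonInitial = NonInitial.nonInitial {o = D} {o′ = B D D}
      (λ eq → ℕ.<⇒≢ (s≤s (ℕ.m≤m+n _ _)) (trans eq (size-apply b-binary _)))
      D-dead (classify-B D-dead D-dead)
      (λ n → B (chain (suc n)) (chain 0)) (λ n → classify-B (classify-chain (suc n)) (classify-chain 0))

-- Choice between the two constructions

theorem5p2 : (S : Signature) → let open Signature S in
    (∃ λ (c : Sym) → arity c ≡ 0) →
    ((∃ λ (f : Sym) → arity f ≡ 2) ⊎
    (∃ λ (f : Sym) → ∃ λ (g : Sym) → f ≢ g × arity f ≡ 1 × arity g ≡ 1)) →
    ∃ λ (A : Algebra S) →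
    ¬ Initial S A × GeneratedByConstants S A × PolynomialTimeWordProblem S A
theorem5p2 S (c , c-nullary) = λ
  { (inj₁ (b , b-binary)) →
      let open Binary.Construction S _≟_ c-nullary b-binary
      in reesQuotient , nonInitial , generated , polynomialTime
  ; (inj₂ (f , g , f≢g , f-unary , g-unary)) →
      let open Unary.Construction S _≟_ c-nullary f-unary g-unary f≢g
      in reesQuotient , nonInitial , generated , polynomialTime
  }
  where
  _≟_ : DecidableEquality (Signature.Sym S)
  _≟_ = inj⇒≟ (↔⇒↣ (proj₂ (Signature.finite S)))
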